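{- Let $t,\vec t$ be closed infinitary lambda trees with $t\vec t$ of type $\iota$. If $t\vec t$ reduces by $n$ head-reduction steps to $\mathfrak f\,r_1\dots r_{\mathrm{ar}(\mathfrak f)}$ with $\mathfrak f\in\Sigma'$, then there are $\mathcal W_1,\dots,\mathcal W_k\in\{\mathcal R,\beta\}$ with $|\{i\mid\mathcal W_i=\beta\}|=n$ such that $\mathrm{cn}(t;\vec t)=\mathcal W_1(\dots(\mathcal W_k(\mathfrak f(r_1^\beta,\dots,r_{\mathrm{ar}(\mathfrak f)}^\beta)))\dots)$.
   Context: $\Sigma'$ ranked alphabet, $\Sigma=\Sigma'\cup\{\mathcal R,\beta\}$ with $\mathcal R,\beta$ unary. Infinitary simply-typed lambda trees: possibly non-well-founded type-correct trees built from variables, $\lambda x^\rho$-abstractions, applications and constants $\mathfrak f\in\Sigma'$ of type $\iota^{\mathrm{ar}(\mathfrak f)}\to\iota$. A head-reduction step rewrites $(\lambda x.s)\,u_1u_2\dots u_m$ to $s[u_1/x]\,u_2\dots u_m$. Continuous normal form (coinductively, for closed $t,\vec t$ with $t\vec t:\iota$): $\mathrm{cn}(rs;\vec t)=\mathcal R(\mathrm{cn}(r;s,\vec t))$, $\mathrm{cn}(\lambda x.r;s,\vec t)=\beta(\mathrm{cn}(r[s/x];\vec t))$, $\mathrm{cn}(\mathfrak f;\vec t)=\mathfrak f(t_1^\beta,\dots,t_n^\beta)$, $t^\beta=\mathrm{cn}(t;())$. -}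

module Defs where

-- Infinite (non-well-founded) trees cannot be coinductive types here
-- (--guardedness / --sized-types are not available), so every infinite
-- tree is represented by its labelling function on finite positions
-- (paths from the root, a path being a list of child indices).  Equality of trees is
-- equality of labels at all positions that actually exist in the tree.

open import Data.Nat using (ℕ; zero; suc; _<_; _<ᵇ_; _≡ᵇ_; pred)
open import Data.Fin using (Fin; fromℕ<)
open import Data.Bool using (Bool; true; false; if_then_else_)
open import Data.Maybe using (Maybe; just; nothing)
open import Data.List using (List; []; _∷_; _∷ʳ_)
open import Data.Vec using (Vec; toList)
open import Data.Product using (Σ; Σ-syntax; _×_)
open import Relation.Nullary using (yes; no)
open import Relation.Binary.PropositionalEquality using (_≡_)
import Data.Nat as ℕ

infixr 7 _⇒_
data Ty : Set where
  ι   : Ty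
  _⇒_ : Ty → Ty → Ty

ιs : ℕ → Ty
ιs zero    = ι
ιs (suc n) = ι ⇒ ιs n

Pos : Set
Pos = List ℕ

_!_ : List Ty → ℕ → Maybe Ty
[]      ! _     = nothing
(σ ∷ Γ) ! zero  = just σ
(σ ∷ Γ) ! suc k = Γ ! k

module Sig (F : Set) (ar : F → ℕ) where

  -- Node labels: variables (de Bruijn indices), λ-abstractions λx^ρ
  -- (one child: the body), applications (child 0 = function,
  -- child 1 = argument), constants 𝔣 ∈ Σ' (no children).

  data Lab : Set where
    var   : ℕ → Lab
    lam   : Ty → Lab
    app   : Lab
    const : F → Lab

  arity : Lab → ℕ
  arity (var _)   = 0
  arity (lam _)   = 1
  arity app       = 2
  arity (const _) = 0

  Tm : Set
  Tm = Pos → Lab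

  _∣_ : Tm → ℕ → Tm
  (T ∣ i) p = T (i ∷ p)

  Valid : Tm → Pos → Set
  Valid T []      = ⊤'
    where open import Data.Unit renaming (⊤ to ⊤')
  Valid T (i ∷ p) = (i < arity (T [])) × Valid (T ∣ i) p

  infix 4 _≃_
  _≃_ : Tm → Tm → Set
  A ≃ B = ∀ p → Valid A p → A p ≡ B p

  ctxAt : List Ty → Tm → Pos → List Ty
  ctxAt Γ T []      = Γ
  ctxAt Γ T (i ∷ p) with T []
  ... | lam ρ = ctxAt (ρ ∷ Γ) (T ∣ i) p
  ... | _     = ctxAt Γ (T ∣ i) p

  LocalOK : List Ty → Lab → Ty → (ℕ → Ty) → Set
  LocalOK Δ (var k)   τ c = Δ ! k ≡ just τ
  LocalOK Δ (lam ρ)   τ c = τ ≡ ρ ⇒ c 0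
  LocalOK Δ app       τ c = c 0 ≡ c 1 ⇒ τ
  LocalOK Δ (const f) τ c = τ ≡ ιs (ar f)

  Typed : List Ty → Tm → Ty → Set
  Typed Γ T σ = Σ[ ty ∈ (Pos → Ty) ] ((ty [] ≡ σ) ×
    (∀ p → Valid T p → LocalOK (ctxAt Γ T p) (T p) (ty p) (λ i → ty (p ∷ʳ i))))

  junk : Lab
  junk = var 0

  mkApp : Tm → Tm → Tm
  mkApp T U []          = app
  mkApp T U (0 ∷ p)     = T p
  mkApp T U (1 ∷ p)     = U p
  mkApp T U (_ ∷ p)     = junk

  apply : Tm → List Tm → Tm
  apply T []       = T
  apply T (u ∷ us) = apply (mkApp T u) us

  leaf : F → Tm
  leaf f _ = const f

  -- substitution r[s/x] for CLOSED s, where x is the variable with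
  -- de Bruijn index 0 at the root of r; d counts λs passed inside r.
  subst : Tm → ℕ → Tm → Tm
  subst r d s p with r []
  subst r d s p       | var k with k ≡ᵇ d
  subst r d s p       | var k | true = s p
  subst r d s []      | var k | false = var (if d <ᵇ k then pred k else k)
  subst r d s (i ∷ p) | var k | false = junk
  subst r d s []      | l = l
  subst r d s (i ∷ p) | lam ρ = subst (r ∣ i) (suc d) s p
  subst r d s (i ∷ p) | l     = subst (r ∣ i) d s p

  _[_] : Tm → Tm → Tm
  r [ s ] = subst r 0 s

  infix 4 _⟶_
  data _⟶_ : Tm → Tm → Set where
    βstep : ∀ {T T' ρ} → T [] ≡ app → (T ∣ 0) [] ≡ lam ρ →
            T' ≃ ((T ∣ 0) ∣ 0) [ T ∣ 1 ] → T ⟶ T'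
    ξstep : ∀ {T A T'} → T [] ≡ app → (T ∣ 0) ⟶ A →
            T' ≃ mkApp A (T ∣ 1) → T ⟶ T'

  data _⟶[_]_ : Tm → ℕ → Tm → Set where
    stop : ∀ {T} → T ⟶[ zero ] T
    step : ∀ {T T' T'' n} → T ⟶ T' → T' ⟶[ n ] T'' → T ⟶[ suc n ] T''

  data LabΣ : Set where
    R β : LabΣ
    sym : F → LabΣ

  arityΣ : LabΣ → ℕ
  arityΣ R       = 1
  arityΣ β       = 1
  arityΣ (sym f) = ar f

  TreeΣ : Set
  TreeΣ = Pos → LabΣ

  _∣Σ_ : TreeΣ → ℕ → TreeΣ
  (X ∣Σ i) p = X (i ∷ p)

  ValidΣ : TreeΣ → Pos → Set
  ValidΣ X []      = ⊤'
    where open import Data.Unit renaming (⊤ to ⊤')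
  ValidΣ X (i ∷ p) = (i < arityΣ (X [])) × ValidΣ (X ∣Σ i) p

  infix 4 _≈_
  _≈_ : TreeΣ → TreeΣ → Set
  X ≈ Y = ∀ p → ValidΣ X p → X p ≡ Y p

  node : (f : F) → (Fin (ar f) → TreeΣ) → TreeΣ
  node f xs []      = sym f
  node f xs (i ∷ p) with i ℕ.<? ar f
  ... | yes i<  = xs (fromℕ< i<) p
  ... | no  _   = R

  -- Continuous normal form cn(t ; t⃗), by recursion on the position:
  --   cn(r s; t⃗)      = R(cn(r; s, t⃗))
  --   cn(λx.r; s, t⃗)  = β(cn(r[s/x]; t⃗))
  --   cn(𝔣; t⃗)        = 𝔣(t₁^β, …, tₙ^β)
  -- (the remaining, ill-typed, cases return junk)

  nth : List Tm → ℕ → Tm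
  nth []       _       = leaf-junk
    where leaf-junk : Tm
          leaf-junk _ = junk
  nth (u ∷ us) zero    = u
  nth (u ∷ us) (suc i) = nth us i

  cn : Tm → List Tm → TreeΣ
  cn t ts p with t []
  cn t ts []      | app     = R
  cn t ts []      | lam _   = β
  cn t ts []      | const f = sym f
  cn t ts []      | var _   = R
  cn t ts (i ∷ p) | app     = cn (t ∣ 0) ((t ∣ 1) ∷ ts) p
  cn t ts (i ∷ p) | lam _ with ts
  ... | []       = R
  ... | s ∷ ts'  = cn ((t ∣ 0) [ s ]) ts' p
  cn t ts (i ∷ p) | const f = cn (nth ts i) [] p
  cn t ts (i ∷ p) | var _   = R

  _ᵝ : Tm → TreeΣ
  t ᵝ = cn t []

  data W : Set where
    𝓡 𝓑 : W

  labW : W → LabΣ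
  labW 𝓡 = R
  labW 𝓑 = β

  wrap : List W → TreeΣ → TreeΣ
  wrap []       X p       = X p
  wrap (w ∷ ws) X []      = labW w
  wrap (w ∷ ws) X (i ∷ p) = wrap ws X p

  countβ : List W → ℕ
  countβ []        = zero
  countβ (𝓡 ∷ ws) = countβ ws
  countβ (𝓑 ∷ ws) = suc (countβ ws)

-- Read t t₁ … tₘ as a spine.  Unfolding cn(t; t⃗) along the spine emits one R per
-- application passed on the way to the head, and contracting the head redex
-- (λx.s) v₁ v₂ … emits one β and continues with cn(s[v₁/x]; v₂, …).  So each
-- head-reduction step only puts a word with exactly one β in front of cn, uniformly in
-- the arguments still waiting outside, and once the head is a constant 𝔣 applied to r⃗
-- only R's separate cn from 𝔣(r⃗^β).

module Submission where

open import Defs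
open import Data.Nat using (ℕ; zero; suc; _+_; _<_; _≡ᵇ_; z<s; s<s)
import Data.Nat as ℕ
open import Data.Bool using (true; false)
open import Data.Empty using (⊥-elim)
open import Data.Fin using (fromℕ<)
open import Data.List using (List; []; _∷_; _++_; _ʳ++_; reverse; replicate)
open import Data.List.Properties using (reverse-involutive)
open import Data.List.Relation.Binary.Pointwise as Pointwise using (Pointwise; []; _∷_)
open import Data.Vec using (Vec; toList; lookup)
import Data.Vec as Vec
open import Data.Product using (Σ-syntax; _×_; _,_)
open import Data.Unit using (tt)
open import Relation.Nullary using (yes; no)
open import Relation.Binary.PropositionalEquality as ≡
  using (_≡_; _≗_; refl; trans; cong; cong₂)

module HeadReduction (F : Set) (ar : F → ℕ) where
  open Sig F ar

  ≡⇒≃ : ∀ {A B} → A ≡ B → A ≃ B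
  ≡⇒≃ refl p v = refl

  child-cong : ∀ {A B l i} → A [] ≡ l → i < arity l → A ≃ B → (A ∣ i) ≃ (B ∣ i)
  child-cong refl i< e q v = e (_ ∷ q) (i< , v)

  Valid-resp : ∀ {A B} → A ≃ B → ∀ p → Valid A p → Valid B p
  Valid-resp e []      v        = tt
  Valid-resp e (i ∷ p) (i< , v) =
    ≡.subst (λ l → i < arity l) (e [] tt) i< , Valid-resp (child-cong refl i< e) p v

  Valid-reflect : ∀ {A B} → A ≃ B → ∀ p → Valid B p → Valid A p
  Valid-reflect e []      v        = tt
  Valid-reflect e (i ∷ p) (i< , v) =
    let i<′ = ≡.subst (λ l → i < arity l) (≡.sym (e [] tt)) i< in
    i<′ , Valid-reflect (child-cong refl i<′ e) p v

  ≃-refl : ∀ {A} → A ≃ A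
  ≃-refl p v = refl

  ≃-sym : ∀ {A B} → A ≃ B → B ≃ A
  ≃-sym e p v = ≡.sym (e p (Valid-reflect e p v))

  ≃-trans : ∀ {A B C} → A ≃ B → B ≃ C → A ≃ C
  ≃-trans e e′ p v = trans (e p v) (e′ p (Valid-resp e p v))

  mkApp-cong : ∀ {A A′ B B′} → A ≃ A′ → B ≃ B′ → mkApp A B ≃ mkApp A′ B′
  mkApp-cong a b []                v       = refl
  mkApp-cong a b (0 ∷ q)           (_ , v) = a q v
  mkApp-cong a b (1 ∷ q)           (_ , v) = b q v
  mkApp-cong a b (suc (suc _) ∷ q) v       = refl

  app-η : ∀ {t} → t [] ≡ app → t ≃ mkApp (t ∣ 0) (t ∣ 1)
  app-η eq []                v        = eq
  app-η eq (0 ∷ q)           v        = refl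
  app-η eq (1 ∷ q)           v        = refl
  app-η eq (suc (suc _) ∷ q) (i< , _) rewrite eq with i<
  ... | s<s (s<s ())

  subst-cong : ∀ {r r′ s s′} → r ≃ r′ → s ≃ s′ → ∀ d → subst r d s ≃ subst r′ d s′
  subst-cong {r} {r′} er es d p v with r [] in eq | r′ [] | er [] tt
  ... | var k | _ | refl with k ≡ᵇ d
  ...   | true  = es p v
  ...   | false with p
  ...     | []    = refl
  ...     | _ ∷ _ = refl
  subst-cong er es d []      v        | lam ρ   | _ | refl = refl
  subst-cong er es d (_ ∷ p) (i< , v) | lam ρ   | _ | refl =
    subst-cong (child-cong eq i< er) es (suc d) p v
  subst-cong er es d []      v        | app     | _ | refl = refl
  subst-cong er es d (_ ∷ p) (i< , v) | app     | _ | refl =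
    subst-cong (child-cong eq i< er) es d p v
  subst-cong er es d []      v        | const f | _ | refl = refl

  nth-cong : ∀ {us us′} → Pointwise _≃_ us us′ → ∀ i → nth us i ≃ nth us′ i
  nth-cong []       i       p v = refl
  nth-cong (e ∷ _)  zero    = e
  nth-cong (_ ∷ es) (suc i) = nth-cong es i

  cn-cong : ∀ {t t′ us us′} → t ≃ t′ → Pointwise _≃_ us us′ → cn t us ≗ cn t′ us′
  cn-cong {t} {t′} e es p with t [] in eq | t′ [] | e [] tt
  cn-cong e es         []      | app     | _ | refl = refl
  cn-cong e es         (_ ∷ p) | app     | _ | refl =
    cn-cong (child-cong eq z<s e) (child-cong eq (s<s z<s) e ∷ es) p
  cn-cong e es         []      | lam _   | _ | refl = refl
  cn-cong e []         (_ ∷ p) | lam _   | _ | refl = refl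
  cn-cong e (eu ∷ es)  (_ ∷ p) | lam _   | _ | refl =
    cn-cong (subst-cong (child-cong eq z<s e) eu 0) es p
  cn-cong e es         []      | const f | _ | refl = refl
  cn-cong e es         (i ∷ p) | const f | _ | refl = cn-cong (nth-cong es i) [] p
  cn-cong e es         []      | var _   | _ | refl = refl
  cn-cong e es         (_ ∷ p) | var _   | _ | refl = refl

  cn-app : ∀ {t} → t [] ≡ app → ∀ us →
           cn t us ≗ wrap (𝓡 ∷ []) (cn (t ∣ 0) ((t ∣ 1) ∷ us))
  cn-app eq us []      rewrite eq = refl
  cn-app eq us (_ ∷ p) rewrite eq = refl

  cn-lam : ∀ {t ρ} → t [] ≡ lam ρ → ∀ u us →
           cn t (u ∷ us) ≗ wrap (𝓑 ∷ []) (cn ((t ∣ 0) [ u ]) us)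
  cn-lam eq u us []      rewrite eq = refl
  cn-lam eq u us (_ ∷ p) rewrite eq = refl

  wrap-cong : ∀ ws {X Y} → X ≗ Y → wrap ws X ≗ wrap ws Y
  wrap-cong []       e p       = e p
  wrap-cong (w ∷ ws) e []      = refl
  wrap-cong (w ∷ ws) e (_ ∷ p) = wrap-cong ws e p

  wrap-++ : ∀ ws ws′ X → wrap (ws ++ ws′) X ≗ wrap ws (wrap ws′ X)
  wrap-++ []       ws′ X p       = refl
  wrap-++ (w ∷ ws) ws′ X []      = refl
  wrap-++ (w ∷ ws) ws′ X (_ ∷ p) = wrap-++ ws ws′ X p

  countβ-++ : ∀ ws ws′ → countβ (ws ++ ws′) ≡ countβ ws + countβ ws′
  countβ-++ []        ws′ = refl
  countβ-++ (𝓡 ∷ ws) ws′ = countβ-++ ws ws′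
  countβ-++ (𝓑 ∷ ws) ws′ = cong suc (countβ-++ ws ws′)

  countβ-replicate-𝓡 : ∀ k → countβ (replicate k 𝓡) ≡ 0
  countβ-replicate-𝓡 zero    = refl
  countβ-replicate-𝓡 (suc k) = countβ-replicate-𝓡 k

  -- A spine (t , vₖ ∷ … ∷ v₁ ∷ []) stands for t v₁ … vₖ: the last argument comes first,
  -- so that the function part of an application is the spine with that argument dropped.
  Spine : Set
  Spine = Tm × List Tm

  applyʳ : Tm → List Tm → Tm
  applyʳ t []       = t
  applyʳ t (v ∷ vs) = mkApp (applyʳ t vs) v

  ⌊_⌋ : Spine → Tm
  ⌊ t , vs ⌋ = applyʳ t vs

  apply-applyʳ : ∀ t us vs → apply (applyʳ t vs) us ≡ applyʳ t (us ʳ++ vs)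
  apply-applyʳ t []       vs = refl
  apply-applyʳ t (u ∷ us) vs = apply-applyʳ t us (u ∷ vs)

  cnˢ : Spine → List Tm → TreeΣ
  cnˢ (t , vs) us = cn t (vs ʳ++ us)

  infix 4 _▷[_]_
  record _▷[_]_ (S : Spine) (n : ℕ) (S′ : Spine) : Set where
    constructor prefixed
    field
      prefix        : List W
      countβ-prefix : countβ prefix ≡ n
      cn-prefix     : ∀ us → cnˢ S us ≗ wrap prefix (cnˢ S′ us)

  ▷-trans : ∀ {S S′ S″ m n} → S ▷[ m ] S′ → S′ ▷[ n ] S″ → S ▷[ m + n ] S″
  ▷-trans {S″ = S″} (prefixed ws count E) (prefixed ws′ count′ E′) =
    prefixed (ws ++ ws′) (trans (countβ-++ ws ws′) (cong₂ _+_ count count′)) λ us p →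
      trans (E us p) (trans (wrap-cong ws (E′ us) p) (≡.sym (wrap-++ ws ws′ (cnˢ S″ us) p)))

  ▷-push : ∀ {t vs t′ vs′ n} u → (t , vs) ▷[ n ] (t′ , vs′) → (t , u ∷ vs) ▷[ n ] (t′ , u ∷ vs′)
  ▷-push u (prefixed ws count E) = prefixed ws count λ us → E (u ∷ us)

  ▷-app : ∀ {t} → t [] ≡ app → (t , []) ▷[ 0 ] (t ∣ 0 , t ∣ 1 ∷ [])
  ▷-app {t} eq = prefixed (𝓡 ∷ []) refl (cn-app {t} eq)

  ▷-lam : ∀ {t ρ} → t [] ≡ lam ρ → ∀ u → (t , u ∷ []) ▷[ 1 ] ((t ∣ 0) [ u ] , [])
  ▷-lam {t} eq u = prefixed (𝓑 ∷ []) refl (cn-lam {t} eq u)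

  ⟶-app : ∀ {T T′} → T ⟶ T′ → T [] ≡ app
  ⟶-app (βstep eq _ _) = eq
  ⟶-app (ξstep eq _ _) = eq

  -- The contracted redex is the innermost application of a spine with arguments; a
  -- spine without arguments is first unfolded at its head application.
  mutual
    head-step : ∀ {T T′} S → T ⟶ T′ → T ≃ ⌊ S ⌋ →
                Σ[ S′ ∈ Spine ] (T′ ≃ ⌊ S′ ⌋ × S ▷[ 1 ] S′)
    head-step (t , []) red h =
      let t-app         = trans (≡.sym (h [] tt)) (⟶-app red)
          S′ , h′ , red′ = head-step⁺ (t ∣ 0) (t ∣ 1) [] red (≃-trans h (app-η t-app))
      in S′ , h′ , ▷-trans (▷-app t-app) red′
    head-step (t , u ∷ vs) red h = head-step⁺ t u vs red h

    head-step⁺ : ∀ {T T′} t u vs → T ⟶ T′ → T ≃ ⌊ t , u ∷ vs ⌋ →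
                 Σ[ S′ ∈ Spine ] (T′ ≃ ⌊ S′ ⌋ × (t , u ∷ vs) ▷[ 1 ] S′)
    head-step⁺ t u [] (βstep eq eq₀ e′) h =
      ((t ∣ 0) [ u ] , []) ,
      ≃-trans e′ (subst-cong (child-cong eq₀ z<s h₀) (child-cong eq (s<s z<s) h) 0) ,
      ▷-lam (trans (≡.sym (h₀ [] tt)) eq₀) u
      where h₀ = child-cong eq z<s h
    head-step⁺ t u (_ ∷ _) (βstep eq eq₀ _) h
      with trans (≡.sym eq₀) (child-cong eq z<s h [] tt)
    ... | ()
    head-step⁺ t u vs (ξstep eq red e′) h with head-step (t , vs) red (child-cong eq z<s h)
    ... | (t′ , vs′) , h′ , red′ =
      (t′ , u ∷ vs′) , ≃-trans e′ (mkApp-cong h′ (child-cong eq (s<s z<s) h)) , ▷-push u red′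

  cn-spine-leaf : ∀ t vs f rs → ⌊ t , vs ⌋ ≃ ⌊ leaf f , rs ⌋ →
    Σ[ k ∈ ℕ ] (∀ {us us′} → Pointwise _≃_ us us′ →
      cnˢ (t , vs) us ≗ wrap (replicate k 𝓡) (cnˢ (leaf f , rs) us′))
  cn-spine-leaf t [] f [] h = 0 , λ es → cn-cong h es
  cn-spine-leaf t [] f (r ∷ rs) h
    with cn-spine-leaf (t ∣ 0) [] f rs (child-cong (h [] tt) z<s h)
  ... | k , E = suc k , λ {us} es p →
    trans (cn-app {t} (h [] tt) us p)
      (trans (wrap-cong (𝓡 ∷ []) (E (child-cong (h [] tt) (s<s z<s) h ∷ es)) p)
        (≡.sym (wrap-++ (𝓡 ∷ []) (replicate k 𝓡) _ p)))
  cn-spine-leaf t (u ∷ vs) f [] h with h [] tt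
  ... | ()
  cn-spine-leaf t (u ∷ vs) f (r ∷ rs) h with cn-spine-leaf t vs f rs (child-cong refl z<s h)
  ... | k , E = k , λ es → E (child-cong refl (s<s z<s) h ∷ es)

  ▷-leaf : ∀ S f rs → ⌊ S ⌋ ≃ ⌊ leaf f , rs ⌋ → S ▷[ 0 ] (leaf f , rs)
  ▷-leaf (t , vs) f rs h =
    let k , E = cn-spine-leaf t vs f rs h in
    prefixed (replicate k 𝓡) (countβ-replicate-𝓡 k) λ _ → E (Pointwise.refl ≃-refl)

  ▷-reduction : ∀ {T U n} S f rs → T ⟶[ n ] U → T ≃ ⌊ S ⌋ → U ≃ ⌊ leaf f , rs ⌋ →
                S ▷[ n ] (leaf f , rs)
  ▷-reduction S f rs stop h hU = ▷-leaf S f rs (≃-trans (≃-sym h) hU)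
  ▷-reduction S f rs (step red reds) h hU with head-step S red h
  ... | S′ , h′ , red′ = ▷-trans red′ (▷-reduction S′ f rs reds h′ hU)

  cn-reduction : ∀ {U n} t ts f rs → apply t ts ⟶[ n ] U → U ≃ apply (leaf f) rs →
    Σ[ ws ∈ List W ] (countβ ws ≡ n × cn t ts ≗ wrap ws (cn (leaf f) rs))
  cn-reduction t ts f rs reds hU =
    let prefixed ws count E =
          ▷-reduction (t , reverse ts) f (reverse rs) reds
            (≡⇒≃ (apply-applyʳ t ts [])) (≃-trans hU (≡⇒≃ (apply-applyʳ (leaf f) rs [])))
    in ws , count ,
       ≡.subst₂ (λ X Y → X ≗ wrap ws Y)
         (cong (cn t) (reverse-involutive ts)) (cong (cn (leaf f)) (reverse-involutive rs))
         (E [])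

  nth-toList : ∀ {m} (rs : Vec Tm m) {i} (i< : i < m) → nth (toList rs) i ≡ lookup rs (fromℕ< i<)
  nth-toList (r Vec.∷ rs) {zero}  z<s       = refl
  nth-toList (r Vec.∷ rs) {suc i} (s<s i<) = nth-toList rs i<

  cn-leaf : ∀ f (rs : Vec Tm (ar f)) → cn (leaf f) (toList rs) ≈ node f (λ i → lookup rs i ᵝ)
  cn-leaf f rs []      v        = refl
  cn-leaf f rs (i ∷ p) (i< , v) with i ℕ.<? ar f
  ... | yes i<′ = cong (λ r → cn r [] p) (nth-toList rs i<′)
  ... | no  i≮  = ⊥-elim (i≮ i<)

  ValidΣ-resp : ∀ {X Y} → X ≗ Y → ∀ p → ValidΣ X p → ValidΣ Y p
  ValidΣ-resp e []      v        = tt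
  ValidΣ-resp e (i ∷ p) (i< , v) =
    ≡.subst (λ l → i < arityΣ l) (e []) i< , ValidΣ-resp (λ q → e (i ∷ q)) p v

  ≗-≈-trans : ∀ {X Y Z} → X ≗ Y → Y ≈ Z → X ≈ Z
  ≗-≈-trans e e′ p v = trans (e p) (e′ p (ValidΣ-resp e p v))

  wrap-cong-≈ : ∀ ws {X Y} → X ≈ Y → wrap ws X ≈ wrap ws Y
  wrap-cong-≈ []       e p       v        = e p v
  wrap-cong-≈ (w ∷ ws) e []      v        = refl
  wrap-cong-≈ (w ∷ ws) e (_ ∷ p) (_ , v) = wrap-cong-≈ ws e p v

lemma5p10 : (F : Set) (ar : F → ℕ) → let open Sig F ar in
    (t : Tm) (ts : List Tm) → Typed [] (apply t ts) ι →
    (n : ℕ) (U : Tm) (f : F) (rs : Vec Tm (ar f)) →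
    apply t ts ⟶[ n ] U →
    U ≃ apply (leaf f) (toList rs) →
    Σ[ ws ∈ List W ] ((countβ ws ≡ n) ×
      (cn t ts ≈ wrap ws (node f (λ i → lookup rs i ᵝ))))
lemma5p10 F ar t ts _ n U f rs reds hU =
  let ws , count , E = cn-reduction t ts f (toList rs) reds hU in
  ws , count , ≗-≈-trans E (wrap-cong-≈ ws (cn-leaf f rs))
  where open HeadReduction F ar
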